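{- (1) Let $S=S_1+S_2\subseteq\mathbb{Z}^n$ be an $\mathrm{L}_2$-convex set, where $S_1,S_2\subseteq\mathbb{Z}^n$ are L-convex sets described for $k=1,2$ as $S_k=\{y\in\mathbb{Z}^n\mid y_j-y_i\le\gamma^{(k)}_{ij}\ ((i,j)\in E_k)\}$ with $E_k\subseteq (N\times N)\setminus\{(i,i)\mid i\in N\}$ and $\gamma^{(k)}_{ij}\in\mathbb{Z}$ for $(i,j)\in E_k$. Let $G_*$ be the associated directed graph. Then $$S=\{x\in\mathbb{Z}^n\mid x(\{j_1,\ldots,j_m\})-x(\{i_1,\ldots,i_m\})\le\gamma(C)\ \text{ for every simple mixed cycle } C \text{ in } G_*\},$$ where $(i_1,j_1,\ldots,i_m,j_m)$ denotes the break vertices of $C$ and $\gamma(C)$ its length. (2) Let $P=P_1+P_2\subseteq\mathbb{R}^n$ be an $\mathrm{L}_2$-convex polyhedron, where $P_1,P_2\subseteq\mathbb{R}^n$ are L-convex polyhedra described for $k=1,2$ as $P_k=\{y\in\mathbb{R}^n\mid y_j-y_i\le\gamma^{(k)}_{ij}\ ((i,j)\in E_k)\}$ with $E_k\subseteq (N\times N)\setminus\{(i,i)\mid i\in N\}$ and $\gamma^{(k)}_{ij}\in\mathbb{R}$ for $(i,j)\in E_k$. Let $G_*$ be the associated directed graph. Then $$P=\{x\in\mathbb{R}^n\mid x(\{j_1,\ldots,j_m\})-x(\{i_1,\ldots,i_m\})\le\gamma(C)\ \text{ for every simple mixed cycle } C \text{ in } G_*\},$$ where $(i_1,j_1,\ldots,i_m,j_m)$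 denotes the break vertices of $C$ and $\gamma(C)$ its length.
   Context: $N=\{1,\ldots,n\}$; for $x\in\mathbb{R}^n$ and $I\subseteq N$, $x(I)=\sum_{i\in I}x_i$; $x\vee y$, $x\wedge y$ are componentwise maximum and minimum; $\mathbf{1}=(1,\ldots,1)$. A nonempty set $S\subseteq\mathbb{Z}^n$ is L-convex if $x,y\in S$ implies $x\vee y,x\wedge y\in S$, and $x\in S,\mu\in\mathbb{Z}$ implies $x+\mu\mathbf{1}\in S$. A nonempty polyhedron $P\subseteq\mathbb{R}^n$ is L-convex if $x,y\in P$ implies $x\vee y,x\wedge y\in P$, and $x\in P,\mu\in\mathbb{R}$ implies $x+\mu\mathbf{1}\in P$. It is known that L-convex sets (resp. polyhedra) are exactly the nonempty sets describable by systems of the form $y_j-y_i\le\gamma_{ij}$ with integer (resp. real) $\gamma_{ij}$, as in the claim. No triangle inequality is imposed on $\gamma^{(k)}$. An $\mathrm{L}_2$-convex set (resp. polyhedron) is the Minkowski sum of two L-convex sets (resp. polyhedra). Graph: $G_*=(N,E_1\cup E_2^\circ)$ is the directed multigraph with vertex set $N$ whose edges are: for each $(i,j)\in E_1$, an edge $(i,j)_1$ from $i$ to $j$ of length $\gamma((i,j)_1)=\gamma^{(1)}_{ij}$ (these form the class $E_1$); and for each $(j,i)\in E_2$, an edge $(i,j)_2$ from $i$ to $j$ (the reversal of the edge in $E_2$) of length $\gamma((i,j)_2)=\gamma^{(2)}_{ji}$ (these form the class $E_2^\circ$). Edges of the two classes are considered distinct (parallel edges may occur). A cycle means a directed cycle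 $C=e_1e_2\cdots e_\ell$ (cyclic sequence of edges, the head of each edge being the tail of the next); its length is $\gamma(C)=\sum_{k=1}^{\ell}\gamma(e_k)$. It is simple if its vertices are all distinct, and mixed if it contains edges from both $E_1$ and $E_2^\circ$. For a mixed cycle $C$, cyclically rotate so that $e_1\in E_1$ and $e_\ell\in E_2^\circ$; then $C$ splits into maximal intervals of consecutive edges alternately in $E_1$ and $E_2^\circ$, with the same number $m\ge1$ of intervals of each class. The break vertices $(i_1,j_1,\ldots,i_m,j_m)$ of $C$ are defined so that the $r$-th $E_1$-interval starts at $i_r$ and ends at $j_r$, and the $r$-th $E_2^\circ$-interval starts at $j_r$ and ends at $i_{r+1}$ (with $i_{m+1}=i_1$), for $r=1,\ldots,m$. -}

module Defs where

open import Data.Fin.Base using (Fin)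
open import Data.Fin.Subset using (Subset; ⁅_⁆; ⋃)
import Data.Integer.Base as ℤ
open ℤ using (ℤ)
open import Data.List.Base as List using (List; []; _∷_)
open import Data.List.Membership.Propositional using (_∈_)
open import Data.List.Relation.Unary.All using (All)
open import Data.List.Relation.Unary.Unique.Propositional using (Unique)
import Data.Nat.Base as ℕ
import Data.Nat.Properties as ℕₚ
open ℕ using (ℕ)
open import Data.Product.Base using (∃; ∃-syntax; Σ-syntax; _×_; _,_; proj₁; proj₂)
import Data.Rational.Base as ℚ
import Data.Rational.Properties as ℚₚ
open ℚ using (ℚ; 0ℚ; ½)
open import Data.Rational.Solver using (module +-*-Solver)
open import Data.Sum.Base using (inj₁; inj₂)
open import Data.Bool.Base using (if_then_else_)
open import Data.Vec.Base using (lookup)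
open import Data.Vec.Functional using (Vector; foldr; zipWith; map)
open import Level using (0ℓ)
open import Relation.Binary.Construct.Closure.ReflexiveTransitive
  using (Star; ε; _◅_; _◅◅_)
open import Relation.Binary.Core using (Rel)
open import Relation.Binary.Definitions using (Decidable; Irreflexive)
open import Relation.Binary.PropositionalEquality
  using (_≡_; _≢_; refl; sym; trans; subst; cong)
open import Relation.Unary using (Pred)

------------------------------------------------------------------------
-- Real numbers: Cauchy sequences of rationals, as a setoid.

IsCauchy : (ℕ → ℚ) → Set
IsCauchy s = ∀ ε → 0ℚ ℚ.< ε →
  ∃[ N ] ∀ m n → N ℕ.≤ m → N ℕ.≤ n → ℚ.∣ s m ℚ.- s n ∣ ℚ.< ε

record ℝ : Set where
  field
    seq    : ℕ → ℚ
    cauchy : IsCauchy seq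

open ℝ public

infix 4 _≈ℝ_ _≤ℝ_

_≈ℝ_ : Rel ℝ 0ℓ
x ≈ℝ y = ∀ ε → 0ℚ ℚ.< ε →
  ∃[ N ] ∀ n → N ℕ.≤ n → ℚ.∣ seq x n ℚ.- seq y n ∣ ℚ.< ε

-- The ε is essential: an eventual termwise inequality would not respect
-- _≈ℝ_.
_≤ℝ_ : Rel ℝ 0ℓ
x ≤ℝ y = ∀ ε → 0ℚ ℚ.< ε →
  ∃[ N ] ∀ n → N ℕ.≤ n → seq x n ℚ.≤ seq y n ℚ.+ ε

module ℚ-Closeness where

  private module Q = ℚₚ.≤-Reasoning

  ∣∣-< : ∀ {p e} → p ℚ.< e → ℚ.- p ℚ.< e → ℚ.∣ p ∣ ℚ.< e
  ∣∣-< {p} {e} p<e -p<e with ℚₚ.∣p∣≡p∨∣p∣≡-p p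
  ... | inj₁ eq = subst (ℚ._< e) (sym eq) p<e
  ... | inj₂ eq = subst (ℚ._< e) (sym eq) -p<e

  p≤∣p∣ : ∀ p → p ℚ.≤ ℚ.∣ p ∣
  p≤∣p∣ p with ℚₚ.≤-total 0ℚ p
  ... | inj₁ 0≤p = ℚₚ.≤-reflexive (sym (ℚₚ.0≤p⇒∣p∣≡p 0≤p))
  ... | inj₂ p≤0 = ℚₚ.≤-trans p≤0 (ℚₚ.0≤∣p∣ p)

  swap-∣-∣ : ∀ a b → ℚ.∣ a ℚ.- b ∣ ≡ ℚ.∣ b ℚ.- a ∣
  swap-∣-∣ a b = trans
    (sym (ℚₚ.∣-p∣≡∣p∣ (a ℚ.- b)))
    (cong ℚ.∣_∣ (solve 2 (λ a b → :- (a :- b) := b :- a) refl a b))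
    where open +-*-Solver

  below : ∀ {a b e} → ℚ.∣ a ℚ.- b ∣ ℚ.< e → a ℚ.< b ℚ.+ e
  below {a} {b} {e} d = begin-strict
    a                 ≡⟨ solve 2 (λ a b → a := b :+ (a :- b)) refl a b ⟩
    b ℚ.+ (a ℚ.- b)   <⟨ ℚₚ.+-monoʳ-< b (ℚₚ.≤-<-trans (p≤∣p∣ (a ℚ.- b)) d) ⟩
    b ℚ.+ e           ∎
    where open Q
          open +-*-Solver

  minus : ∀ {a b e} → a ℚ.< b ℚ.+ e → a ℚ.- b ℚ.< e
  minus {a} {b} {e} h = begin-strict
    a ℚ.- b           <⟨ ℚₚ.+-monoˡ-< (ℚ.- b) h ⟩
    (b ℚ.+ e) ℚ.- b   ≡⟨ solve 2 (λ b e → (b :+ e) :- b := e) refl b e ⟩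
    e                 ∎
    where open Q
          open +-*-Solver

  close : ∀ {a b e} → a ℚ.< b ℚ.+ e → b ℚ.< a ℚ.+ e → ℚ.∣ a ℚ.- b ∣ ℚ.< e
  close {a} {b} {e} h k = ∣∣-< (minus h)
    (subst (ℚ._< e) (solve 2 (λ a b → b :- a := :- (a :- b)) refl a b) (minus k))
    where open +-*-Solver

  ⊔-below : ∀ {a b c d e} → a ℚ.< c ℚ.+ e → b ℚ.< d ℚ.+ e →
            a ℚ.⊔ b ℚ.< (c ℚ.⊔ d) ℚ.+ e
  ⊔-below {a} {b} {c} {d} {e} h k with ℚₚ.⊔-sel a b
  ... | inj₁ eq = subst (ℚ._< _) (sym eq)
                    (ℚₚ.<-≤-trans h (ℚₚ.+-monoˡ-≤ e (ℚₚ.p≤p⊔q c d)))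
  ... | inj₂ eq = subst (ℚ._< _) (sym eq)
                    (ℚₚ.<-≤-trans k (ℚₚ.+-monoˡ-≤ e (ℚₚ.p≤q⊔p c d)))

  ⊓-below : ∀ {a b c d e} → a ℚ.< c ℚ.+ e → b ℚ.< d ℚ.+ e →
            a ℚ.⊓ b ℚ.< (c ℚ.⊓ d) ℚ.+ e
  ⊓-below {a} {b} {c} {d} {e} h k with ℚₚ.⊓-sel c d
  ... | inj₁ eq = subst (λ z → _ ℚ.< z ℚ.+ e) (sym eq) (ℚₚ.≤-<-trans (ℚₚ.p⊓q≤p a b) h)
  ... | inj₂ eq = subst (λ z → _ ℚ.< z ℚ.+ e) (sym eq) (ℚₚ.≤-<-trans (ℚₚ.p⊓q≤q a b) k)

  ⊔-close : ∀ a b c d {e} → ℚ.∣ a ℚ.- c ∣ ℚ.< e → ℚ.∣ b ℚ.- d ∣ ℚ.< e →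
            ℚ.∣ (a ℚ.⊔ b) ℚ.- (c ℚ.⊔ d) ∣ ℚ.< e
  ⊔-close a b c d {e} h k =
    close (⊔-below {a} {b} {c} {d} (below h) (below k)) (⊔-below {c} {d} {a} {b}
      (below (subst (ℚ._< e) (swap-∣-∣ a c) h)) (below (subst (ℚ._< e) (swap-∣-∣ b d) k)))

  ⊓-close : ∀ a b c d {e} → ℚ.∣ a ℚ.- c ∣ ℚ.< e → ℚ.∣ b ℚ.- d ∣ ℚ.< e →
            ℚ.∣ (a ℚ.⊓ b) ℚ.- (c ℚ.⊓ d) ∣ ℚ.< e
  ⊓-close a b c d {e} h k =
    close (⊓-below {a} {b} {c} {d} (below h) (below k)) (⊓-below {c} {d} {a} {b}
      (below (subst (ℚ._< e) (swap-∣-∣ a c) h)) (below (subst (ℚ._< e) (swap-∣-∣ b d) k)))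

  +-close : ∀ a b c d {e} → ℚ.∣ a ℚ.- c ∣ ℚ.< ½ ℚ.* e → ℚ.∣ b ℚ.- d ∣ ℚ.< ½ ℚ.* e →
            ℚ.∣ (a ℚ.+ b) ℚ.- (c ℚ.+ d) ∣ ℚ.< e
  +-close a b c d {e} h k = begin-strict
    ℚ.∣ (a ℚ.+ b) ℚ.- (c ℚ.+ d) ∣
      ≡⟨ cong ℚ.∣_∣ (solve 4 (λ a b c d → (a :+ b) :- (c :+ d) := (a :- c) :+ (b :- d)) refl a b c d) ⟩
    ℚ.∣ (a ℚ.- c) ℚ.+ (b ℚ.- d) ∣        ≤⟨ ℚₚ.∣p+q∣≤∣p∣+∣q∣ (a ℚ.- c) (b ℚ.- d) ⟩
    ℚ.∣ a ℚ.- c ∣ ℚ.+ ℚ.∣ b ℚ.- d ∣      <⟨ ℚₚ.+-mono-< h k ⟩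
    ½ ℚ.* e ℚ.+ ½ ℚ.* e                  ≡⟨ sym (ℚₚ.*-distribʳ-+ e ½ ½) ⟩
    (½ ℚ.+ ½) ℚ.* e                      ≡⟨ ℚₚ.*-identityˡ e ⟩
    e                                    ∎
    where open Q
          open +-*-Solver

  neg-close : ∀ a b {e} → ℚ.∣ a ℚ.- b ∣ ℚ.< e → ℚ.∣ (ℚ.- a) ℚ.- (ℚ.- b) ∣ ℚ.< e
  neg-close a b {e} h = subst (ℚ._< e)
    (trans (swap-∣-∣ a b)
      (cong ℚ.∣_∣ (solve 2 (λ a b → b :- a := (:- a) :- (:- b)) refl a b))) h
    where open +-*-Solver

  half-pos : ∀ e → 0ℚ ℚ.< e → 0ℚ ℚ.< ½ ℚ.* e
  half-pos e 0<e = subst (ℚ._< ½ ℚ.* e) (ℚₚ.*-zeroʳ ½) (ℚₚ.*-monoʳ-<-pos ½ 0<e)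

  cauchy₂ : (_∙_ : ℚ → ℚ → ℚ) (f : ℚ → ℚ) →
            (∀ e → 0ℚ ℚ.< e → 0ℚ ℚ.< f e) →
            (∀ a b c d {e} → ℚ.∣ a ℚ.- c ∣ ℚ.< f e → ℚ.∣ b ℚ.- d ∣ ℚ.< f e →
               ℚ.∣ (a ∙ b) ℚ.- (c ∙ d) ∣ ℚ.< e) →
            (x y : ℝ) → IsCauchy (λ n → seq x n ∙ seq y n)
  cauchy₂ _∙_ f f-pos cl x y e 0<e
    with cauchy x (f e) (f-pos e 0<e) | cauchy y (f e) (f-pos e 0<e)
  ... | M , hx | N , hy = M ℕ.⊔ N , λ m n p q →
    cl (seq x m) (seq y m) (seq x n) (seq y n)
      (hx m n (ℕₚ.m⊔n≤o⇒m≤o M N p) (ℕₚ.m⊔n≤o⇒m≤o M N q))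
      (hy m n (ℕₚ.m⊔n≤o⇒n≤o M N p) (ℕₚ.m⊔n≤o⇒n≤o M N q))

open ℚ-Closeness

0ℝ : ℝ
0ℝ = record { seq = λ _ → 0ℚ ; cauchy = λ _ 0<e → 0 , λ _ _ _ _ → 0<e }

_+ℝ_ : ℝ → ℝ → ℝ
x +ℝ y = record
  { seq    = λ n → seq x n ℚ.+ seq y n
  ; cauchy = cauchy₂ ℚ._+_ (½ ℚ.*_) half-pos +-close x y }

-ℝ_ : ℝ → ℝ
-ℝ x = record
  { seq    = λ n → ℚ.- seq x n
  ; cauchy = λ e 0<e → let N , h = cauchy x e 0<e in
      N , λ m n p q → neg-close (seq x m) (seq x n) (h m n p q) }

_⊔ℝ_ : ℝ → ℝ → ℝ
x ⊔ℝ y = record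
  { seq    = λ n → seq x n ℚ.⊔ seq y n
  ; cauchy = cauchy₂ ℚ._⊔_ (λ e → e) (λ _ p → p) ⊔-close x y }

_⊓ℝ_ : ℝ → ℝ → ℝ
x ⊓ℝ y = record
  { seq    = λ n → seq x n ℚ.⊓ seq y n
  ; cauchy = cauchy₂ ℚ._⊓_ (λ e → e) (λ _ p → p) ⊓-close x y }

------------------------------------------------------------------------
-- The operations shared by ℤ and ℝ.  No laws are assumed: the record is
-- only ever used at the two instances below.

record Scalars : Set₁ where
  infix  4 _≈_ _≤_
  infixl 6 _+_ _-_ _⊔_
  infixl 7 _⊓_
  infix  8 -_
  field
    Carrier : Set
    _≈_ _≤_ : Rel Carrier 0ℓ
    0#      : Carrier
    _+_     : Carrier → Carrier → Carrier
    -_      : Carrier → Carrier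
    _⊔_ _⊓_ : Carrier → Carrier → Carrier

  _-_ : Carrier → Carrier → Carrier
  x - y = x + (- y)

ℤ-scalars : Scalars
ℤ-scalars = record
  { Carrier = ℤ ; _≈_ = _≡_ ; _≤_ = ℤ._≤_ ; 0# = ℤ.0ℤ
  ; _+_ = ℤ._+_ ; -_ = ℤ.-_ ; _⊔_ = ℤ._⊔_ ; _⊓_ = ℤ._⊓_ }

ℝ-scalars : Scalars
ℝ-scalars = record
  { Carrier = ℝ ; _≈_ = _≈ℝ_ ; _≤_ = _≤ℝ_ ; 0# = 0ℝ
  ; _+_ = _+ℝ_ ; -_ = -ℝ_ ; _⊔_ = _⊔ℝ_ ; _⊓_ = _⊓ℝ_ }

------------------------------------------------------------------------

data Class : Set where
  E₁ E₂° : Class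

module _ (A : Scalars) where
  open Scalars A

  PointSet : ℕ → Set₁
  PointSet n = Pred (Vector Carrier n) 0ℓ

  sumOver : ∀ {n} → Vector Carrier n → Subset n → Carrier
  sumOver x I = foldr _+_ 0# (λ i → if lookup I i then x i else 0#)

  -- For ℝ the notion is about polyhedra.  Polyhedrality and compatibility
  -- with _≈_ are not fields because the predicate is only applied to sets
  -- that are given as solution sets of finitely many linear inequalities.
  record IsLConvex {n} (S : PointSet n) : Set where
    field
      nonempty : ∃ S
      ∨-closed : ∀ {x y} → S x → S y → S (zipWith _⊔_ x y)
      ∧-closed : ∀ {x y} → S x → S y → S (zipWith _⊓_ x y)
      shift    : ∀ {x} → S x → ∀ μ → S (map (_+ μ) x)

  MinkowskiSum : ∀ {n} → PointSet n → PointSet n → PointSet n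
  MinkowskiSum S T x = ∃[ y ] ∃[ z ] S y × T z × (∀ i → x i ≈ y i + z i)

  -- A set E of off-diagonal pairs with a number γ i j for each (i , j) in
  -- E.  Decidability of E is what makes it a subset of the finite set
  -- N × N in the classical sense; irrelevance makes γ depend on the pair
  -- only, not on the proof of membership.
  record System (n : ℕ) : Set₁ where
    field
      E            : Rel (Fin n) 0ℓ
      E?           : Decidable E
      off-diagonal : Irreflexive _≡_ E
      γ            : ∀ i j → .(E i j) → Carrier

  Solutions : ∀ {n} → System n → PointSet n
  Solutions D y = ∀ i j (e : E i j) → y j - y i ≤ γ i j e
    where open System D

  module Graph {n} (D₁ D₂ : System n) where
    private
      module D₁ = System D₁
      module D₂ = System D₂

    data Edge : Rel (Fin n) 0ℓ where
      edge₁  : ∀ {i j} → .(D₁.E i j) → Edge i j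
      edge₂° : ∀ {i j} → .(D₂.E j i) → Edge i j

    class : ∀ {i j} → Edge i j → Class
    class (edge₁ _)  = E₁
    class (edge₂° _) = E₂°

    edgeLength : ∀ {i j} → Edge i j → Carrier
    edgeLength (edge₁  {i} {j} e) = D₁.γ i j e
    edgeLength (edge₂° {i} {j} e) = D₂.γ j i e

    Walk : Rel (Fin n) 0ℓ
    Walk = Star Edge

    walkLength : ∀ {i j} → Walk i j → Carrier
    walkLength ε       = 0#
    walkLength (e ◅ p) = edgeLength e + walkLength p

    classes : ∀ {i j} → Walk i j → List Class
    classes ε       = []
    classes (e ◅ p) = class e ∷ classes p

    -- The tails of the edges; the final vertex is not listed, so that on
    -- a closed walk every vertex of the cycle is listed once per visit.
    tails : ∀ {i j} → Walk i j → List (Fin n)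
    tails ε             = []
    tails (_◅_ {i} e p) = i ∷ tails p

    -- A cycle is a closed walk Walk v v; its base point v is immaterial.

    Simple : ∀ {v} → Walk v v → Set
    Simple C = Unique (tails C)

    Mixed : ∀ {v} → Walk v v → Set
    Mixed C = E₁ ∈ classes C × E₂° ∈ classes C

    Interval : Class → ∀ {i j} → Walk i j → Set
    Interval c p = classes p ≢ [] × All (_≡ c) (classes p)

    -- Decomposition of a walk into intervals, alternately in E₁ and E₂°,
    -- beginning with E₁ and ending with E₂°; the list records
    -- (i₁ , j₁) ∷ … ∷ (iₘ , jₘ) ∷ [].  On a closed walk the alternation
    -- makes the intervals maximal, cyclically as well.
    data Splits : ∀ {i k} → Walk i k → List (Fin n × Fin n) → Set where
      done : ∀ {i} → Splits (ε {x = i}) []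
      step : ∀ {i j k l} {p : Walk i j} {q : Walk j k} {r : Walk k l} {bs} →
             Interval E₁ p → Interval E₂° q → Splits r bs →
             Splits (p ◅◅ q ◅◅ r) ((i , j) ∷ bs)

    -- Some cyclic rotation of C splits with break vertices bs.
    BreakVertices : ∀ {v} → Walk v v → List (Fin n × Fin n) → Set
    BreakVertices {v} C bs =
      ∃[ u ] Σ[ p ∈ Walk v u ] Σ[ q ∈ Walk u v ]
        C ≡ p ◅◅ q × Splits (q ◅◅ p) bs

    starts ends : List (Fin n × Fin n) → Subset n
    starts bs = ⋃ (List.map (λ b → ⁅ proj₁ b ⁆) bs)
    ends   bs = ⋃ (List.map (λ b → ⁅ proj₂ b ⁆) bs)

    CycleInequalities : PointSet n
    CycleInequalities x =
      ∀ {v} (C : Walk v v) → Simple C → Mixed C →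
      ∀ bs → BreakVertices C bs →
      sumOver x (ends bs) - sumOver x (starts bs) ≤ walkLength C

{-# OPTIONS --safe #-}

-- Write x = y + z.  Then z = x − y solves the second system iff, on every
-- E₂° edge i → j, y j − y i is at most the length of the edge plus
-- x j − x i.  So x lies in the Minkowski sum iff G⁎, with the E₂° edges
-- reweighted in this way, admits a potential y.  A potential exists iff no
-- simple cycle has negative weight: y is minus the shortest walk distance,
-- computed à la Bellman–Ford, which needs meets but no decidable order.  Pure
-- cycles have nonnegative weight because S₁ and S₂ are nonempty; on a mixed
-- cycle the corrections x j − x i telescope along each E₂° interval, and
-- nonnegativity becomes exactly the cycle inequality.

module Submission where

open import Defs
open import Data.Nat.Base using (ℕ)
open import Data.Product.Base using (_×_)
open import Relation.Unary using (_≐_)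

open import Algebra.Bundles using (AbelianGroup)
import Algebra.Properties.Group as GroupProperties
import Algebra.Solver.CommutativeMonoid as CommutativeMonoidSolver
open import Algebra.Structures using (IsAbelianGroup)
open import Data.Bool.Base using (if_then_else_)
open import Data.Fin.Base using (Fin; zero; suc)
import Data.Fin.Properties as Fin
open import Data.Fin.Subset as Subset using (⁅_⁆; ⋃; _∪_; inside; outside)
import Data.Fin.Subset.Properties as Subset
import Data.Integer.Base as ℤ
import Data.Integer.Properties as ℤ
open import Data.List.Base as List using (List; []; _∷_; _++_; length)
open import Data.List.Membership.Propositional using (_∈_; lose)
import Data.List.Membership.Propositional.Properties as ∈
open import Data.List.Relation.Binary.Permutation.Propositional using (↭⇒↭ₛ)
import Data.List.Relation.Binary.Permutation.Propositional.Properties as ↭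
import Data.List.Relation.Binary.Permutation.Setoid.Properties as ↭ₛ
open import Data.List.Relation.Binary.Sublist.Propositional as Sublist using (_⊆_; _∷ʳ_)
import Data.List.Relation.Binary.Sublist.Propositional.Properties as Sublist
open import Data.List.Relation.Unary.All as All using (All; []; _∷_)
import Data.List.Relation.Unary.All.Properties as All
open import Data.List.Relation.Unary.AllPairs using ([]; _∷_)
open import Data.List.Relation.Unary.Any using (here; there)
open import Data.List.Relation.Unary.Unique.Propositional using (Unique)
import Data.Nat.Base as ℕ
import Data.Nat.Properties as ℕ
open import Data.Product.Base using (∃; Σ-syntax; _,_; proj₁; proj₂)
open import Data.Rational.Base as ℚ using (ℚ; 0ℚ; ½)
import Data.Rational.Properties as ℚ
open import Data.Rational.Solver using (module +-*-Solver)
open import Data.Sum.Base using (_⊎_; inj₁; inj₂)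
open import Data.Unit.Base using (⊤; tt)
open import Data.Vec.Base using (_∷_; here; there)
open import Data.Vec.Functional using (Vector)
open import Function.Base using (_∘_; const)
open import Level using (0ℓ)
open import Relation.Binary.Construct.Closure.ReflexiveTransitive using (ε; _◅_; _◅◅_)
open import Relation.Binary.Construct.Closure.ReflexiveTransitive.Properties using (◅◅-assoc)
open import Relation.Binary.Bundles using (Poset)
open import Relation.Binary.Lattice.Structures using (IsMeetSemilattice)
open import Relation.Binary.Structures using (IsEquivalence)
open import Relation.Binary.PropositionalEquality as ≡
  using (_≡_; _≢_; refl; sym; trans; cong; subst)
import Relation.Binary.Reasoning.PartialOrder as PartialOrderReasoning
import Relation.Binary.Reasoning.Setoid as SetoidReasoning
open import Relation.Nullary using (Dec; yes; no; contradiction; recompute)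
open import Relation.Nullary.Negation using (contradiction-irr)
open import Relation.Unary using (Pred)

open ℚ-Closeness

-- Abelian groups with a compatible meet-semilattice order

-- Structure common to `ℤ` and the Cauchy reals. Potentials are built with `+`, `-` and `⊓` inside
-- the carrier, so over `ℤ` they are integral, and one argument serves both cases.
record IsMeetOrderedGroup (A : Scalars) : Set where
  open Scalars A
  field
    isAbelianGroup    : IsAbelianGroup _≈_ _+_ 0# (-_)
    isMeetSemilattice : IsMeetSemilattice _≈_ _≤_ _⊓_
    +-mono-≤          : ∀ {a b c d} → a ≤ b → c ≤ d → a + c ≤ b + d

module OrderedGroup {A : Scalars} (L : IsMeetOrderedGroup A) where
  open Scalars A public
  open IsMeetOrderedGroup L public
  open IsMeetSemilattice isMeetSemilattice public
    using (isPartialOrder; x∧y≤x; x∧y≤y; ∧-greatest)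

  abelianGroup : AbelianGroup 0ℓ 0ℓ
  abelianGroup = record { isAbelianGroup = isAbelianGroup }

  open AbelianGroup abelianGroup public
    using (setoid; commutativeMonoid; group)
    renaming ( refl to ≈-refl; sym to ≈-sym; trans to ≈-trans
             ; ∙-cong to +-cong; ∙-congˡ to +-congˡ; ∙-congʳ to +-congʳ; assoc to +-assoc; comm to +-comm
             ; identityˡ to +-identityˡ; identityʳ to +-identityʳ
             ; inverseˡ to +-inverseˡ )
  open GroupProperties group public
    using () renaming (//-rightDividesˡ to x-y+y≈x; //-rightDividesʳ to x+y-y≈x; ∙-cancelʳ to +-cancelʳ)

  poset : Poset 0ℓ 0ℓ 0ℓ
  poset = record { isPartialOrder = isPartialOrder }

  open Poset poset public
    using () renaming (refl to ≤-refl; reflexive to ≤-reflexive; trans to ≤-trans)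

  module ≤-Reasoning = PartialOrderReasoning poset
  module ≈-Reasoning = SetoidReasoning setoid
  module Solver      = CommutativeMonoidSolver commutativeMonoid

  +-cancelʳ-≤ : ∀ c {a b} → a + c ≤ b + c → a ≤ b
  +-cancelʳ-≤ c {a} {b} a+c≤b+c = begin
    a            ≈⟨ x+y-y≈x c a ⟨
    a + c - c    ≤⟨ +-mono-≤ a+c≤b+c ≤-refl ⟩
    b + c - c    ≈⟨ x+y-y≈x c b ⟩
    b            ∎
    where open ≤-Reasoning

  x-y≤z⇒x≤z+y : ∀ {x y z} → x - y ≤ z → x ≤ z + y
  x-y≤z⇒x≤z+y {x} {y} x-y≤z =
    ≤-trans (≤-reflexive (≈-sym (x-y+y≈x y x))) (+-mono-≤ x-y≤z ≤-refl)

  x≤z+y⇒x-y≤z : ∀ {x y z} → x ≤ z + y → x - y ≤ z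
  x≤z+y⇒x-y≤z {x} {y} x≤z+y =
    +-cancelʳ-≤ y (≤-trans (≤-reflexive (x-y+y≈x y x)) x≤z+y)

  -- Turns the shortest-distance inequality along an edge of weight `c` into the potential
  -- inequality for the negated distances.
  neg-swap-≤ : ∀ {a b c} → a ≤ c + b → - b ≤ c - a
  neg-swap-≤ {a} {b} {c} a≤c+b = +-cancelʳ-≤ (a + b) (begin
    - b + (a + b)      ≈⟨ solve 3 (λ a b b⁻ → b⁻ ⊕ (a ⊕ b) ⊜ a ⊕ (b⁻ ⊕ b)) ≈-refl a b (- b) ⟩
    a + (- b + b)      ≈⟨ +-congˡ (+-inverseˡ b) ⟩
    a + 0#             ≈⟨ +-identityʳ a ⟩
    a                  ≤⟨ a≤c+b ⟩
    c + b              ≈⟨ +-congʳ (x-y+y≈x a c) ⟨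
    (c - a + a) + b    ≈⟨ +-assoc (c - a) a b ⟩
    c - a + (a + b)    ∎)
    where open ≤-Reasoning
          open Solver

  -- Finite meets, and sums over lists and subsets

  module _ {B : Set} (f : B → Carrier) where

    -- The meet includes `0#` even when the list is nonempty: in `dist` this is the weight of the
    -- empty walk.
    ⨅ : List B → Carrier
    ⨅ = List.foldr (λ b m → f b ⊓ m) 0#

    ⨅≤0 : ∀ bs → ⨅ bs ≤ 0#
    ⨅≤0 []       = ≤-refl
    ⨅≤0 (b ∷ bs) = ≤-trans (x∧y≤y (f b) (⨅ bs)) (⨅≤0 bs)

    ⨅-lower : ∀ {b bs} → b ∈ bs → ⨅ bs ≤ f b
    ⨅-lower {bs = b ∷ bs} (here refl) = x∧y≤x (f b) (⨅ bs)
    ⨅-lower {bs = b ∷ bs} (there b∈)  = ≤-trans (x∧y≤y (f b) (⨅ bs)) (⨅-lower b∈)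

    ⨅-greatest : ∀ {c} → c ≤ 0# → (∀ b → c ≤ f b) → ∀ bs → c ≤ ⨅ bs
    ⨅-greatest c≤0 c≤f []       = c≤0
    ⨅-greatest c≤0 c≤f (b ∷ bs) = ∧-greatest (c≤f b) (⨅-greatest c≤0 c≤f bs)

  ∑ : {B : Set} → (B → Carrier) → List B → Carrier
  ∑ f = List.foldr (λ b → f b +_) 0#

  sumOver-⊥ : ∀ {n} (x : Vector Carrier n) → sumOver A x Subset.⊥ ≈ 0#
  sumOver-⊥ {ℕ.zero}  x = ≈-refl
  sumOver-⊥ {ℕ.suc n} x = ≈-trans (+-identityˡ _) (sumOver-⊥ (x ∘ suc))

  sumOver-insert : ∀ {n} (x : Vector Carrier n) i {I} → i Subset.∉ I →
                   sumOver A x (⁅ i ⁆ ∪ I) ≈ x i + sumOver A x I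
  sumOver-insert x zero {outside ∷ I} i∉I = begin
    x zero + sumOver A (x ∘ suc) (Subset.⊥ ∪ I)   ≡⟨ cong (λ J → x zero + sumOver A (x ∘ suc) J) (Subset.∪-identityˡ I) ⟩
    x zero + sumOver A (x ∘ suc) I                ≈⟨ +-congˡ (+-identityˡ _) ⟨
    x zero + (0# + sumOver A (x ∘ suc) I)         ∎
    where open ≈-Reasoning
  sumOver-insert x zero {inside ∷ I} i∉I = contradiction here i∉I
  sumOver-insert x (suc i) {b ∷ I} i∉I = begin
    x₀ + sumOver A (x ∘ suc) (⁅ i ⁆ ∪ I)          ≈⟨ +-congˡ (sumOver-insert (x ∘ suc) i (i∉I ∘ there)) ⟩
    x₀ + (x (suc i) + sumOver A (x ∘ suc) I)      ≈⟨ solve 3 (λ a b c → a ⊕ (b ⊕ c) ⊜ b ⊕ (a ⊕ c)) ≈-refl x₀ _ _ ⟩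
    x (suc i) + (x₀ + sumOver A (x ∘ suc) I)      ∎
    where open ≈-Reasoning
          open Solver
          x₀ = if b then x zero else 0#

  -- A subset forgets multiplicities, so the two sums are compared on a list without repetitions.
  sumOver-⋃ : ∀ {n} {B : Set} (x : Vector Carrier n) (f : B → Fin n) bs → Unique (List.map f bs) →
              sumOver A x (⋃ (List.map (λ b → ⁅ f b ⁆) bs)) ≈ ∑ (x ∘ f) bs
  sumOver-⋃ x f []       []        = sumOver-⊥ x
  sumOver-⋃ x f (b ∷ bs) (fb∉ ∷ u) = ≈-trans
    (sumOver-insert x (f b) λ fb∈ → All.lookup fb∉ (∈-⋃⁻ bs fb∈) refl)
    (+-congˡ (sumOver-⋃ x f bs u))
    where
    ∈-⋃⁻ : ∀ {i} bs → i Subset.∈ ⋃ (List.map (λ b → ⁅ f b ⁆) bs) → i ∈ List.map f bs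
    ∈-⋃⁻ []       i∈ = contradiction i∈ Subset.∉⊥
    ∈-⋃⁻ (b ∷ bs) i∈ with Subset.x∈p∪q⁻ ⁅ f b ⁆ _ i∈
    ... | inj₁ i∈⁅fb⁆ = here (Subset.x∈⁅y⁆⇒x≡y (f b) i∈⁅fb⁆)
    ... | inj₂ i∈⋃    = there (∈-⋃⁻ bs i∈⋃)

-- Lists without repetition

Unique-resp-⊆ : {B : Set} {xs ys : List B} → xs ⊆ ys → Unique ys → Unique xs
Unique-resp-⊆ Sublist.[]         []       = []
Unique-resp-⊆ (y ∷ʳ s)           (_ ∷ u)  = Unique-resp-⊆ s u
Unique-resp-⊆ (refl Sublist.∷ s) (x∉ ∷ u) = Sublist.All-resp-⊆ s x∉ ∷ Unique-resp-⊆ s u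

-- Pigeonhole: indexing into the list is an injection into `Fin n`. It bounds the number of edges of
-- a loop-erased walk.
Unique⇒length≤ : ∀ {n} {xs : List (Fin n)} → Unique xs → length xs ℕ.≤ n
Unique⇒length≤ u = Fin.injective⇒≤ (lookup-injective u)
  where
  lookup-injective : ∀ {xs : List (Fin _)} → Unique xs → ∀ {i j} → List.lookup xs i ≡ List.lookup xs j → i ≡ j
  lookup-injective (_ ∷ _)  {zero}  {zero}  _  = refl
  lookup-injective (x∉ ∷ _) {zero}  {suc j} eq = contradiction eq (All.lookup x∉ (∈.∈-lookup j))
  lookup-injective (x∉ ∷ _) {suc i} {zero}  eq = contradiction (sym eq) (All.lookup x∉ (∈.∈-lookup i))
  lookup-injective (_ ∷ u)  {suc i} {suc j} eq = cong suc (lookup-injective u eq)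

Unique-++-swap : {B : Set} (xs ys : List B) → Unique (xs ++ ys) → Unique (ys ++ xs)
Unique-++-swap xs ys = ↭ₛ.Unique-resp-↭ (≡.setoid _) (↭⇒↭ₛ (↭.++-comm xs ys))

-- Walks, and the break vertices of a mixed cycle

module Walks {A : Scalars} {n} (D₁ D₂ : System A n) where
  open Graph A D₁ D₂
  private
    module D₁ = System D₁
    module D₂ = System D₂

  classes-◅◅ : ∀ {i j k} (p : Walk i j) (q : Walk j k) → classes (p ◅◅ q) ≡ classes p ++ classes q
  classes-◅◅ ε       q = refl
  classes-◅◅ (e ◅ p) q = cong (class e ∷_) (classes-◅◅ p q)

  tails-◅◅ : ∀ {i j k} (p : Walk i j) (q : Walk j k) → tails (p ◅◅ q) ≡ tails p ++ tails q
  tails-◅◅ ε             q = refl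
  tails-◅◅ (_◅_ {i} e p) q = cong (i ∷_) (tails-◅◅ p q)

  ◅◅-ε : ∀ {i j} (p : Walk i j) → p ◅◅ ε ≡ p
  ◅◅-ε ε       = refl
  ◅◅-ε (e ◅ p) = cong (e ◅_) (◅◅-ε p)

  -- Used for loop erasure: an edge from `i` to `j` followed by `q` is a simple cycle, and dropping
  -- it leaves the walk `r` from `i`.
  firstVisit : ∀ {i j k} (p : Walk j k) → i ∈ tails p → Unique (tails p) →
               Σ[ q ∈ Walk j i ] Σ[ r ∈ Walk i k ]
               p ≡ q ◅◅ r × Unique (i ∷ tails q) × Unique (tails r)
  firstVisit (e ◅ p) (here refl) u = ε , e ◅ p , refl , [] ∷ [] , u
  firstVisit {i} (_◅_ {j} e p) (there i∈) (j∉ ∷ u)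
    with firstVisit p i∈ u
  ... | q , r , refl , i∉ ∷ uq , ur =
    e ◅ q , r , refl ,
    ((λ i≡j → All.lookup j∉ i∈ (sym i≡j)) ∷ i∉) ∷
    All.++⁻ˡ (tails q) (subst (All (j ≢_)) (tails-◅◅ q r) j∉) ∷ uq ,
    ur

  -- Deciding membership in both systems makes the edges a finite list, over which a meet can be
  -- taken; parallel edges of the two classes stay separate.
  edgesBetween : ∀ i j → List (∃ (Edge i))
  edgesBetween i j = edges₁ (D₁.E? i j) ++ edges₂ (D₂.E? j i)
    where
    edges₁ : Dec (D₁.E i j) → List (∃ (Edge i))
    edges₁ (yes e) = (j , edge₁ e) ∷ []
    edges₁ (no _)  = []
    edges₂ : Dec (D₂.E j i) → List (∃ (Edge i))
    edges₂ (yes e) = (j , edge₂° e) ∷ []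
    edges₂ (no _)  = []

  ∈-edgesBetween : ∀ {i j} (e : Edge i j) → (j , e) ∈ edgesBetween i j
  ∈-edgesBetween {i} {j} (edge₁ e) with D₁.E? i j
  -- Membership proofs are irrelevant, so the listed edge and the given one are equal by definition.
  ... | yes _ = here refl
  ... | no ¬e = contradiction-irr e ¬e
  ∈-edgesBetween {i} {j} (edge₂° e) with D₂.E? j i
  ... | yes _ = ∈.∈-++⁺ʳ _ (here refl)
  ... | no ¬e = contradiction-irr e ¬e

  outEdges : ∀ i → List (∃ (Edge i))
  outEdges i = List.concatMap (edgesBetween i) (List.allFin n)

  ∈-outEdges : ∀ {i j} (e : Edge i j) → (j , e) ∈ outEdges i
  ∈-outEdges {i} {j} e =
    ∈.∈-concatMap⁺ (edgesBetween i) (lose (∈.∈-allFin j) (∈-edgesBetween e))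

  all-E₁⊎E₂°∈ : ∀ cs → All (_≡ E₁) cs ⊎ E₂° ∈ cs
  all-E₁⊎E₂°∈ []         = inj₁ []
  all-E₁⊎E₂°∈ (E₂° ∷ cs) = inj₂ (here refl)
  all-E₁⊎E₂°∈ (E₁ ∷ cs) with all-E₁⊎E₂°∈ cs
  ... | inj₁ all = inj₁ (refl ∷ all)
  ... | inj₂ E₂∈ = inj₂ (there E₂∈)

  all-E₂°⊎E₁∈ : ∀ cs → All (_≡ E₂°) cs ⊎ E₁ ∈ cs
  all-E₂°⊎E₁∈ []         = inj₁ []
  all-E₂°⊎E₁∈ (E₁ ∷ cs) = inj₂ (here refl)
  all-E₂°⊎E₁∈ (E₂° ∷ cs) with all-E₂°⊎E₁∈ cs
  ... | inj₁ all = inj₁ (refl ∷ all)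
  ... | inj₂ E₁∈ = inj₂ (there E₁∈)

  All-◅◅ : ∀ {P : Pred Class 0ℓ} {i j k} (p : Walk i j) (q : Walk j k) →
           All P (classes p) → All P (classes q) → All P (classes (p ◅◅ q))
  All-◅◅ p q Pp Pq = subst (All _) (sym (classes-◅◅ p q)) (All.++⁺ Pp Pq)

  -- A walk may begin with `E₂°` or end with `E₁`; what is left over at its two ends is kept apart,
  -- to be joined by rotation when the walk is closed.
  record Decomposition {i k} (w : Walk i k) : Set where
    constructor decomposition
    field
      {u v}       : Fin n
      prefix      : Walk i u
      middle      : Walk u v
      suffix      : Walk v k
      breaks      : List (Fin n × Fin n)
      prefix-E₂°  : All (_≡ E₂°) (classes prefix)
      splits      : Splits middle breaks
      suffix-E₁   : All (_≡ E₁) (classes suffix)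
      recomposed  : w ≡ prefix ◅◅ middle ◅◅ suffix

  -- Edges are added at the front. An `E₂°` edge always joins the prefix; the place of an `E₁` edge
  -- depends on what follows it.
  decompose : ∀ {i k} (w : Walk i k) → Decomposition w
  decompose ε = decomposition ε ε ε [] [] done [] refl
  decompose (e@(edge₂° _) ◅ w) with decompose w
  ... | decomposition a s b bs A₂ sp B₁ refl =
    decomposition (e ◅ a) s b bs (refl ∷ A₂) sp B₁ refl
  decompose (e@(edge₁ _) ◅ w) with decompose w
  ... | decomposition ε _ b [] _ done B₁ refl =
    decomposition ε ε (e ◅ b) [] [] done (refl ∷ B₁) refl
  -- The middle already starts with an `E₁` interval, which absorbs the edge.
  ... | decomposition ε _ b _ _ (step {p = p} {q} {r} (_ , P₁) Iq sr) B₁ refl =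
    decomposition ε (e ◅ (p ◅◅ q ◅◅ r)) b _ [] (step {p = e ◅ p} ((λ ()) , refl ∷ P₁) Iq sr) B₁ refl
  -- The nonempty prefix becomes the `E₂°` interval of a new first pair, whose `E₁` interval is the
  -- single edge.
  ... | decomposition a@(_ ◅ _) s b bs A₂ sp B₁ refl =
    decomposition ε ((e ◅ ε) ◅◅ a ◅◅ s) b _ []
      (step ((λ ()) , refl ∷ []) ((λ ()) , A₂) sp) B₁
      (cong (e ◅_) (sym (◅◅-assoc a s b)))

  -- The last interval is in `E₂°` and its final vertex is not recorded, so it can absorb `a` with
  -- the same break vertices.
  splits-extend : ∀ {i j k b bs} {s : Walk i j} (a : Walk j k) →
                  Splits s (b ∷ bs) → All (_≡ E₂°) (classes a) → Splits (s ◅◅ a) (b ∷ bs)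
  splits-extend a (step {p = p} {q} Ip (q≢ , Q₂) done) A₂ =
    subst (λ w → Splits w _)
      (trans (cong (λ q → p ◅◅ q) (trans (◅◅-ε (q ◅◅ a)) (cong (_◅◅ a) (sym (◅◅-ε q)))))
             (sym (◅◅-assoc p (q ◅◅ ε) a)))
      (step Ip (nonempty q q≢ , All-◅◅ q a Q₂ A₂) done)
    where
    nonempty : ∀ {j} (q : Walk j _) → classes q ≢ [] → classes (q ◅◅ a) ≢ []
    nonempty ε       q≢ = contradiction refl q≢
    nonempty (_ ◅ _) q≢ ()
  splits-extend a (step {p = p} {q} {r} Ip Iq sr@(step _ _ _)) A₂ =
    subst (λ w → Splits w _)
      (sym (trans (◅◅-assoc p (q ◅◅ r) a) (cong (λ q → p ◅◅ q) (◅◅-assoc q r a))))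
      (step Ip Iq (splits-extend a sr A₂))

  breakVertices : ∀ {v} (C : Walk v v) → Mixed C → ∃ (BreakVertices C)
  breakVertices C (E₁∈ , E₂∈) with decompose C
  ... | decomposition a s ε [] A₂ done _ refl
      = contradiction (All.lookup (All-◅◅ a ε A₂ []) E₁∈) λ ()
  -- With no suffix, the prefix moves to the end and lengthens the last `E₂°` interval.
  ... | decomposition a s ε (b ∷ bs) A₂ sp _ refl =
    b ∷ bs , _ , a , s , cong (λ q → a ◅◅ q) (◅◅-ε s) , splits-extend a sp A₂
  ... | decomposition ε _ b@(_ ◅ _) [] _ done B₁ refl
      = contradiction (All.lookup B₁ E₂∈) λ ()
  -- With no prefix, the suffix moves to the front and lengthens the first `E₁` interval, whose
  -- start is now `u`.
  ... | decomposition {v = u} ε s b@(_ ◅ _) _ _ (step {j = j} {p = p} {q} {r} {bs} (_ , P₁) Iq sr) B₁ refl =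
    _ , _ , s , b , refl ,
    subst (λ w → Splits w ((u , j) ∷ bs)) (◅◅-assoc b p (q ◅◅ r))
      (step ((λ ()) , All-◅◅ b p B₁ P₁) Iq sr)
  -- Suffix and prefix meet at the base point and form one new pair of intervals, placed before the
  -- middle.
  ... | decomposition a@(_ ◅ _) s b@(_ ◅ _) bs A₂ sp B₁ refl =
    _ , _ , a ◅◅ s , b , sym (◅◅-assoc a s b) ,
    step ((λ ()) , B₁) ((λ ()) , A₂) sp

  -- Nonempty `E₁` intervals make each start the tail of an edge. A sublist, unlike mere membership,
  -- inherits the distinctness of the vertices of a simple cycle.
  splits-starts-⊆ : ∀ {i k bs} {s : Walk i k} → Splits s bs → List.map proj₁ bs ⊆ tails s
  splits-starts-⊆ done = Sublist.[]
  splits-starts-⊆ (step {p = ε} (p≢ , _) _ _) = contradiction refl p≢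
  splits-starts-⊆ (step {p = e ◅ p} {q} {r} _ _ sr) =
    refl Sublist.∷ subst (_ ⊆_) (sym (trans (tails-◅◅ p (q ◅◅ r)) (cong (tails p ++_) (tails-◅◅ q r))))
      (Sublist.++⁺ˡ (tails p) (Sublist.++⁺ˡ (tails q) (splits-starts-⊆ sr)))

  -- Since `tails` omits the final vertex of a walk, each end is found as the tail of the first edge
  -- of the `E₂°` interval after it.
  splits-ends-⊆ : ∀ {i k bs} {s : Walk i k} → Splits s bs → List.map proj₂ bs ⊆ tails s
  splits-ends-⊆ done = Sublist.[]
  splits-ends-⊆ (step {q = ε} _ (q≢ , _) _) = contradiction refl q≢
  splits-ends-⊆ (step {p = p} {q = e ◅ q} {r} _ _ sr) =
    subst (_ ⊆_) (sym (trans (tails-◅◅ p (e ◅ q ◅◅ r)) (cong (λ l → tails p ++ (_ ∷ l)) (tails-◅◅ q r))))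
      (Sublist.++⁺ˡ (tails p) (refl Sublist.∷ Sublist.++⁺ˡ (tails q) (splits-ends-⊆ sr)))

-- Potentials and shortest walks

module Potentials {A : Scalars} (L : IsMeetOrderedGroup A) {n} (D₁ D₂ : System A n)
                  (w : ∀ {i j} → Graph.Edge A D₁ D₂ i j → Scalars.Carrier A) where
  open OrderedGroup L
  open Graph A D₁ D₂
  open Walks D₁ D₂
  open import Data.List.Membership.DecPropositional (Fin._≟_ {n}) using (_∈?_)

  weight : ∀ {i j} → Walk i j → Carrier
  weight ε       = 0#
  weight (e ◅ p) = w e + weight p

  weight-◅◅ : ∀ {i j k} (p : Walk i j) (q : Walk j k) → weight (p ◅◅ q) ≈ weight p + weight q
  weight-◅◅ ε       q = ≈-sym (+-identityˡ (weight q))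
  weight-◅◅ (e ◅ p) q = ≈-trans (+-congˡ (weight-◅◅ p q)) (≈-sym (+-assoc (w e) (weight p) (weight q)))

  -- Restriction to a class lets a solution of just one system act as a potential on the pure cycles
  -- of its class.
  PotentialOn : Pred Class 0ℓ → Vector Carrier n → Set
  PotentialOn P y = ∀ {i j} (e : Edge i j) → P (class e) → y j ≤ w e + y i

  Potential : Vector Carrier n → Set
  Potential = PotentialOn (const ⊤)

  telescope : ∀ {P y} → PotentialOn P y → ∀ {i j} (p : Walk i j) → All P (classes p) → y j ≤ weight p + y i
  telescope {y = y} pot {i} ε _ = ≤-reflexive (≈-sym (+-identityˡ (y i)))
  telescope {y = y} pot {i} (_◅_ {j = j} e p) (Pe ∷ Pp) = begin
    _                          ≤⟨ telescope pot p Pp ⟩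
    weight p + y j             ≤⟨ +-mono-≤ ≤-refl (pot e Pe) ⟩
    weight p + (w e + y i)     ≈⟨ solve 3 (λ a b c → a ⊕ (b ⊕ c) ⊜ (b ⊕ a) ⊕ c) ≈-refl (weight p) (w e) (y i) ⟩
    (w e + weight p) + y i     ∎
    where open ≤-Reasoning
          open Solver

  cycle-nonneg : ∀ {P y} → PotentialOn P y → ∀ {v} (C : Walk v v) → All P (classes C) → 0# ≤ weight C
  cycle-nonneg {y = y} pot {v} C PC =
    +-cancelʳ-≤ (y v) (≤-trans (≤-reflexive (+-identityˡ (y v))) (telescope pot C PC))

  -- Bellman–Ford: the least weight of a walk from i with at most k edges.
  dist : ℕ → Fin n → Carrier
  dist ℕ.zero    i = 0#
  dist (ℕ.suc k) i = ⨅ (λ (j , e) → w e + dist k j) (outEdges i)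

  dist-lower : ∀ k {i j} (p : Walk i j) → length (tails p) ℕ.≤ k → dist k i ≤ weight p
  dist-lower ℕ.zero    ε       _ = ≤-refl
  -- The empty walk at a positive stage is covered by the `0#` in `⨅`.
  dist-lower (ℕ.suc k) ε       _ = ⨅≤0 _ (outEdges _)
  dist-lower (ℕ.suc k) (e ◅ p) (ℕ.s≤s |p|≤k) =
    ≤-trans (⨅-lower _ (∈-outEdges e)) (+-mono-≤ ≤-refl (dist-lower k p |p|≤k))

  -- Without a decidable order no walk attaining `dist k i` can be picked out; this universal
  -- property takes the place of such a walk.
  dist-greatest : ∀ k {i c} → (∀ {j} (p : Walk i j) → c ≤ weight p) → c ≤ dist k i
  dist-greatest ℕ.zero    c≤ = c≤ ε
  dist-greatest (ℕ.suc k) {i} {c} c≤ = ⨅-greatest _ (c≤ ε) c≤step (outEdges i)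
    where
    c≤step : ∀ ((j , e) : ∃ (Edge i)) → c ≤ w e + dist k j
    -- `w e` is subtracted from `c` so that the induction applies to walks from `j`, and is then
    -- added back.
    c≤step (j , e) = ≤-trans
      (x-y≤z⇒x≤z+y (dist-greatest k λ p → x≤z+y⇒x-y≤z
        (≤-trans (c≤ (e ◅ p)) (≤-reflexive (+-comm (w e) (weight p))))))
      (≤-reflexive (+-comm (dist k j) (w e)))

  module _ (nonneg : ∀ {v} (C : Walk v v) → Simple C → 0# ≤ weight C) where

    -- The walk after the first edge is loop-erased first. If it returns to `i`, the edge closes a
    -- simple cycle, and cutting off its nonnegative weight does not raise the total.
    loopErase : ∀ {i k} (p : Walk i k) → Σ[ q ∈ Walk i k ] Unique (tails q) × weight q ≤ weight p
    loopErase ε = ε , [] , ≤-refl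
    loopErase (_◅_ {i} e p) with loopErase p
    ... | q , uq , q≤p with i ∈? tails q
    ... | no i∉q = e ◅ q , All.¬Any⇒All¬ _ i∉q ∷ uq , +-mono-≤ ≤-refl q≤p
    ... | yes i∈q with firstVisit q i∈q uq
    ... | loop , r , refl , simple , ur = r , ur , (begin
      weight r                          ≈⟨ +-identityˡ (weight r) ⟨
      0# + weight r                     ≤⟨ +-mono-≤ (nonneg (e ◅ loop) simple) ≤-refl ⟩
      (w e + weight loop) + weight r    ≈⟨ +-assoc (w e) (weight loop) (weight r) ⟩
      w e + (weight loop + weight r)    ≈⟨ +-congˡ (weight-◅◅ loop r) ⟨
      w e + weight (loop ◅◅ r)          ≤⟨ +-mono-≤ ≤-refl q≤p ⟩
      w e + weight p                    ∎)
      where open ≤-Reasoning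

    -- Every walk `p` from `j` gives the walk `e ◅ p` from `i`, so `dist n i - w e` is a lower bound
    -- for walks from `j`, hence at most `dist n j`.
    potential : ∃ Potential
    potential = (λ i → - dist n i) , λ {i} {j} e _ → neg-swap-≤ (≤-trans
      (x-y≤z⇒x≤z+y (dist-greatest n λ p → x≤z+y⇒x-y≤z (begin
        dist n i             ≤⟨ dist-n-lower (e ◅ p) ⟩
        w e + weight p       ≈⟨ +-comm (w e) (weight p) ⟩
        weight p + w e       ∎)))
      (≤-reflexive (+-comm (dist n j) (w e))))
      where
      open ≤-Reasoning
      dist-n-lower : ∀ {i j} (p : Walk i j) → dist n i ≤ weight p
      -- `p` may have more than `n` edges, but its loop erasure does not; so stage `n` bounds walks
      -- of every length.
      dist-n-lower p = let q , uq , q≤p = loopErase p in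
        ≤-trans (dist-lower n q (Unique⇒length≤ uq)) q≤p

-- Cycle inequalities and the Minkowski sum

module Decomposability {A : Scalars} (L : IsMeetOrderedGroup A) {n} (D₁ D₂ : System A n) where
  open OrderedGroup L
  open Graph A D₁ D₂
  open Walks D₁ D₂
  private
    module D₁ = System D₁
    module D₂ = System D₂

  walkLength-◅◅ : ∀ {i j k} (p : Walk i j) (q : Walk j k) →
                  walkLength (p ◅◅ q) ≈ walkLength p + walkLength q
  walkLength-◅◅ ε       q = ≈-sym (+-identityˡ (walkLength q))
  walkLength-◅◅ (e ◅ p) q =
    ≈-trans (+-congˡ (walkLength-◅◅ p q)) (≈-sym (+-assoc (edgeLength e) (walkLength p) (walkLength q)))

  module _ (x : Vector Carrier n) where

    reweighted : ∀ {i j} → Edge i j → Carrier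
    reweighted         (edge₁ e)  = edgeLength (edge₁ e)
    reweighted {i} {j} (edge₂° e) = edgeLength (edge₂° e) + (x j - x i)

    open Potentials L D₁ D₂ reweighted

    weight-E₁ : ∀ {i j} (p : Walk i j) → All (_≡ E₁) (classes p) → weight p ≈ walkLength p
    weight-E₁ ε                 []       = ≈-refl
    weight-E₁ (edge₁ _ ◅ p)     (_ ∷ P₁) = +-congˡ (weight-E₁ p P₁)
    weight-E₁ (edge₂° _ ◅ p)    (() ∷ _)

    weight-E₂° : ∀ {i j} (q : Walk i j) → All (_≡ E₂°) (classes q) →
                 weight q + x i ≈ walkLength q + x j
    weight-E₂° ε                []       = ≈-refl
    weight-E₂° (edge₁ _ ◅ q)    (() ∷ _)
    weight-E₂° {i} {k} (_◅_ {j = j} e@(edge₂° _) q) (_ ∷ Q₂) = begin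
      ((l + (x j - x i)) + weight q) + x i      ≈⟨ solve 4 (λ l d w a → ((l ⊕ d) ⊕ w) ⊕ a ⊜ l ⊕ (w ⊕ (d ⊕ a))) ≈-refl l (x j - x i) (weight q) (x i) ⟩
      l + (weight q + (x j - x i + x i))        ≈⟨ +-congˡ (+-congˡ (x-y+y≈x (x i) (x j))) ⟩
      l + (weight q + x j)                      ≈⟨ +-congˡ (weight-E₂° q Q₂) ⟩
      l + (walkLength q + x k)                  ≈⟨ +-assoc l (walkLength q) (x k) ⟨
      (l + walkLength q) + x k                  ∎
      where open ≈-Reasoning
            open Solver
            l = edgeLength e

    -- ∑ x jᵣ is on the left and ∑ x iᵣ on the right, so that no subtraction occurs.
    weight-splits : ∀ {i k bs} {s : Walk i k} → Splits s bs →
                    weight s + (∑ (x ∘ proj₂) bs + x i) ≈ walkLength s + (∑ (x ∘ proj₁) bs + x k)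
    weight-splits done = ≈-refl
    weight-splits {i} {l} (step {j = j} {k} {p = p} {q} {r} {bs} (_ , P₁) (_ , Q₂) sr) = begin
      weight (p ◅◅ q ◅◅ r) + ((x j + e) + x i)
        ≈⟨ +-congʳ (≈-trans (weight-◅◅ p (q ◅◅ r)) (+-congˡ (weight-◅◅ q r))) ⟩
      (weight p + (weight q + weight r)) + ((x j + e) + x i)
        ≈⟨ solve 6 (λ p q r j e i → (p ⊕ (q ⊕ r)) ⊕ ((j ⊕ e) ⊕ i) ⊜ p ⊕ ((q ⊕ j) ⊕ (r ⊕ (e ⊕ i)))) ≈-refl
             (weight p) (weight q) (weight r) (x j) e (x i) ⟩
      weight p + ((weight q + x j) + (weight r + (e + x i)))
        -- The `E₂°` interval trades `x j` for `x k`, the term that the induction on `r`, a walk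
        -- from `k`, requires.
        ≈⟨ +-cong (weight-E₁ p P₁) (+-congʳ (weight-E₂° q Q₂)) ⟩
      walkLength p + ((walkLength q + x k) + (weight r + (e + x i)))
        ≈⟨ solve 6 (λ p q k r e i → p ⊕ ((q ⊕ k) ⊕ (r ⊕ (e ⊕ i))) ⊜ p ⊕ (q ⊕ ((r ⊕ (e ⊕ k)) ⊕ i))) ≈-refl
             (walkLength p) (walkLength q) (x k) (weight r) e (x i) ⟩
      walkLength p + (walkLength q + ((weight r + (e + x k)) + x i))
        ≈⟨ +-congˡ (+-congˡ (+-congʳ (weight-splits sr))) ⟩
      walkLength p + (walkLength q + ((walkLength r + (b + x l)) + x i))
        ≈⟨ solve 6 (λ p q r b l i → p ⊕ (q ⊕ ((r ⊕ (b ⊕ l)) ⊕ i)) ⊜ (p ⊕ (q ⊕ r)) ⊕ ((i ⊕ b) ⊕ l)) ≈-refl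
             (walkLength p) (walkLength q) (walkLength r) b (x l) (x i) ⟩
      (walkLength p + (walkLength q + walkLength r)) + ((x i + b) + x l)
        ≈⟨ +-congʳ (≈-trans (walkLength-◅◅ p (q ◅◅ r)) (+-congˡ (walkLength-◅◅ q r))) ⟨
      walkLength (p ◅◅ q ◅◅ r) + ((x i + b) + x l) ∎
      where open ≈-Reasoning
            open Solver
            e = ∑ (x ∘ proj₂) bs
            b = ∑ (x ∘ proj₁) bs

    -- Weight and length are invariant under rotation, so both are computed at `u`, where the
    -- splitting starts; there the two boundary terms `x u` cancel. Simplicity turns the list sums
    -- into subset sums.
    weight-cycle : ∀ {v} (C : Walk v v) → Simple C → ∀ bs → BreakVertices C bs →
                   weight C + sumOver A x (ends bs) ≈ walkLength C + sumOver A x (starts bs)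
    weight-cycle C simple bs (u , p , q , refl , sp) = begin
      weight (p ◅◅ q) + sumOver A x (ends bs)
        ≈⟨ +-cong (≈-trans (weight-◅◅ p q) (≈-trans (+-comm _ _) (≈-sym (weight-◅◅ q p))))
                  (sumOver-⋃ x proj₂ bs (Unique-resp-⊆ (splits-ends-⊆ sp) unique)) ⟩
      weight (q ◅◅ p) + ∑ (x ∘ proj₂) bs
        ≈⟨ +-cancelʳ (x u) _ _ (≈-trans (+-assoc _ _ _)
             (≈-trans (weight-splits sp) (≈-sym (+-assoc _ _ _)))) ⟩
      walkLength (q ◅◅ p) + ∑ (x ∘ proj₁) bs
        ≈⟨ +-cong (≈-trans (walkLength-◅◅ q p) (≈-trans (+-comm _ _) (≈-sym (walkLength-◅◅ p q))))
                  (≈-sym (sumOver-⋃ x proj₁ bs (Unique-resp-⊆ (splits-starts-⊆ sp) unique))) ⟩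
      walkLength (p ◅◅ q) + sumOver A x (starts bs) ∎
      where
      open ≈-Reasoning
      unique : Unique (tails (q ◅◅ p))
      unique = subst Unique (sym (tails-◅◅ q p))
        (Unique-++-swap (tails p) (tails q) (subst Unique (tails-◅◅ p q) simple))

    module _ {y z : Vector Carrier n} (x≈y+z : ∀ i → x i ≈ y i + z i) where

      -- Both sides equal `γ + x j`. Cancelling `z i` or `y j` then carries the inequality for `z`
      -- to the one for `y`, or back.
      edge₂°-sides : ∀ i j .(e : D₂.E j i) →
        (reweighted (edge₂° {i} {j} e) + y i) + z i ≈ (D₂.γ j i e + z j) + y j
      edge₂°-sides i j e = begin
        ((γ + (x j - x i)) + y i) + z i    ≈⟨ +-assoc (γ + (x j - x i)) (y i) (z i) ⟩
        (γ + (x j - x i)) + (y i + z i)    ≈⟨ +-congˡ (x≈y+z i) ⟨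
        (γ + (x j - x i)) + x i            ≈⟨ +-assoc γ (x j - x i) (x i) ⟩
        γ + (x j - x i + x i)              ≈⟨ +-congˡ (x-y+y≈x (x i) (x j)) ⟩
        γ + x j                            ≈⟨ +-congˡ (≈-trans (x≈y+z j) (+-comm (y j) (z j))) ⟩
        γ + (z j + y j)                    ≈⟨ +-assoc γ (z j) (y j) ⟨
        (γ + z j) + y j                    ∎
        where open ≈-Reasoning
              γ = D₂.γ j i e

      solution₂⇒potential : Solutions A D₂ z → PotentialOn (_≡ E₂°) y
      solution₂⇒potential z∈ (edge₁ _) ()
      solution₂⇒potential z∈ {i} {j} (edge₂° e) _ = +-cancelʳ-≤ (z i) (begin
        y j + z i                                   ≈⟨ +-comm (y j) (z i) ⟩
        -- The edge holds its membership proof irrelevantly; decidability recovers a proof to which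
        -- `z∈` applies.
        z i + y j                                   ≤⟨ +-mono-≤ (x-y≤z⇒x≤z+y (z∈ j i (recompute (D₂.E? j i) e))) ≤-refl ⟩
        (D₂.γ j i e + z j) + y j                    ≈⟨ edge₂°-sides i j e ⟨
        (reweighted (edge₂° {i} {j} e) + y i) + z i ∎)
        where open ≤-Reasoning

      potential⇒solution₂ : PotentialOn (_≡ E₂°) y → Solutions A D₂ z
      potential⇒solution₂ pot j i e = x≤z+y⇒x-y≤z (+-cancelʳ-≤ (y j) (begin
        z i + y j                                   ≈⟨ +-comm (z i) (y j) ⟩
        y j + z i                                   ≤⟨ +-mono-≤ (pot (edge₂° e) refl) ≤-refl ⟩
        (reweighted (edge₂° {i} {j} e) + y i) + z i ≈⟨ edge₂°-sides i j e ⟩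
        (D₂.γ j i e + z j) + y j                    ∎))
        where open ≤-Reasoning

    solution₁⇒potential : ∀ {y} → Solutions A D₁ y → PotentialOn (_≡ E₁) y
    solution₁⇒potential y∈ {i} {j} (edge₁ e) _ = x-y≤z⇒x≤z+y (y∈ i j (recompute (D₁.E? i j) e))
    solution₁⇒potential y∈ (edge₂° _) ()

    potential⇒solution₁ : ∀ {y} → PotentialOn (_≡ E₁) y → Solutions A D₁ y
    potential⇒solution₁ pot i j e = x≤z+y⇒x-y≤z (pot (edge₁ e) refl)

    sum⇒cycleInequalities : MinkowskiSum A (Solutions A D₁) (Solutions A D₂) x → CycleInequalities x
    sum⇒cycleInequalities (y , z , y∈ , z∈ , x≈y+z) C simple _ bs bv = x≤z+y⇒x-y≤z (begin
      sumOver A x (ends bs)                    ≈⟨ +-identityˡ _ ⟨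
      0# + sumOver A x (ends bs)               ≤⟨ +-mono-≤ (cycle-nonneg pot C (All.universal (const tt) (classes C))) ≤-refl ⟩
      weight C + sumOver A x (ends bs)         ≈⟨ weight-cycle C simple bs bv ⟩
      walkLength C + sumOver A x (starts bs)   ∎)
      where
      open ≤-Reasoning
      pot : Potential y
      pot (edge₁ e)  _ = solution₁⇒potential y∈ (edge₁ e) refl
      pot (edge₂° e) _ = solution₂⇒potential x≈y+z z∈ (edge₂° e) refl

    module _ (sol₁ : ∃ (Solutions A D₁)) (sol₂ : ∃ (Solutions A D₂)) (x∈ : CycleInequalities x) where

      y+[x-y]≈x : ∀ (y : Vector Carrier n) i → x i ≈ y i + (x i - y i)
      y+[x-y]≈x y i = ≈-sym (≈-trans (+-comm (y i) (x i - y i)) (x-y+y≈x (y i) (x i)))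

      -- The cycle inequalities speak of mixed cycles only; solutions of the two systems settle the
      -- pure ones.
      simpleCycle-nonneg : ∀ {v} (C : Walk v v) → Simple C → 0# ≤ weight C
      simpleCycle-nonneg C simple with all-E₁⊎E₂°∈ (classes C) | all-E₂°⊎E₁∈ (classes C)
      ... | inj₁ C₁ | _ = cycle-nonneg (solution₁⇒potential (proj₂ sol₁)) C C₁
      -- Writing `x` as `(x - z) + z`, with `z` any solution of the second system, makes `x - z` a
      -- potential on the `E₂°` edges.
      ... | inj₂ _ | inj₁ C₂ = cycle-nonneg (solution₂⇒potential x≈[x-z]+z z∈) C C₂
        where
        z  = proj₁ sol₂
        z∈ = proj₂ sol₂
        x≈[x-z]+z : ∀ i → x i ≈ (x i - z i) + z i
        x≈[x-z]+z i = ≈-sym (x-y+y≈x (z i) (x i))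
      ... | inj₂ E₂∈ | inj₂ E₁∈ = let bs , bv = breakVertices C (E₁∈ , E₂∈) in
        +-cancelʳ-≤ (sumOver A x (ends bs)) (begin
          0# + sumOver A x (ends bs)               ≈⟨ +-identityˡ _ ⟩
          sumOver A x (ends bs)                    ≤⟨ x-y≤z⇒x≤z+y (x∈ C simple (E₁∈ , E₂∈) bs bv) ⟩
          walkLength C + sumOver A x (starts bs)   ≈⟨ weight-cycle C simple bs bv ⟨
          weight C + sumOver A x (ends bs)         ∎)
        where open ≤-Reasoning

      cycleInequalities⇒sum : MinkowskiSum A (Solutions A D₁) (Solutions A D₂) x
      cycleInequalities⇒sum = let y , pot = potential simpleCycle-nonneg in
        y , (λ i → x i - y i) ,
        potential⇒solution₁ (λ e _ → pot e tt) ,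
        potential⇒solution₂ (y+[x-y]≈x y) (λ e _ → pot e tt) ,
        y+[x-y]≈x y

  sum≐cycleInequalities : ∀ {S S₁ S₂ : PointSet A n} → IsLConvex A S₁ → IsLConvex A S₂ →
    S₁ ≐ Solutions A D₁ → S₂ ≐ Solutions A D₂ → S ≐ MinkowskiSum A S₁ S₂ → S ≐ CycleInequalities
  sum≐cycleInequalities S₁-convex S₂-convex (S₁⊆ , ⊆S₁) (S₂⊆ , ⊆S₂) (S⊆ , ⊆S) =
    (λ {x} x∈S → let y , z , y∈ , z∈ , x≈y+z = S⊆ x∈S in
       sum⇒cycleInequalities x (y , z , S₁⊆ y∈ , S₂⊆ z∈ , x≈y+z)) ,
    (λ {x} x∈ →
       let s₁ , s₁∈ = IsLConvex.nonempty S₁-convex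
           s₂ , s₂∈ = IsLConvex.nonempty S₂-convex
           y , z , y∈ , z∈ , x≈y+z = cycleInequalities⇒sum x (s₁ , S₁⊆ s₁∈) (s₂ , S₂⊆ s₂∈) x∈
       in ⊆S (y , z , ⊆S₁ y∈ , ⊆S₂ z∈ , x≈y+z))

-- The integers as an instance

ℤ-isMeetOrderedGroup : IsMeetOrderedGroup ℤ-scalars
ℤ-isMeetOrderedGroup = record
  { isAbelianGroup    = ℤ.+-0-isAbelianGroup
  ; isMeetSemilattice = record
    { isPartialOrder = ℤ.≤-isPartialOrder
    ; infimum        = λ i j → ℤ.i⊓j≤i i j , ℤ.i⊓j≤j i j , λ k → ℤ.⊓-glb }
  ; +-mono-≤          = ℤ.+-mono-≤ }

-- The Cauchy reals as an instance

-- From here on reals are passed explicitly: `x ≤ℝ y` unfolds to a statement about `seq x` and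
-- `seq y`, from which unification cannot recover `x` and `y`.
≤ℝ-lift₁ : ∀ {a b c d : ℝ} →
  (∀ n {e} → seq a n ℚ.≤ seq b n ℚ.+ e → seq c n ℚ.≤ seq d n ℚ.+ e) → a ≤ℝ b → c ≤ℝ d
≤ℝ-lift₁ f a≤b e 0<e = let N , h = a≤b e 0<e in N , λ n N≤n → f n (h n N≤n)

-- `f` is the share of the tolerance given to each hypothesis: half where errors add up, all of it
-- for meets.
≤ℝ-lift₂ : ∀ (f : ℚ → ℚ) (f-pos : ∀ e → 0ℚ ℚ.< e → 0ℚ ℚ.< f e) {a b c d u v : ℝ} →
  (∀ n {e} → seq a n ℚ.≤ seq b n ℚ.+ f e → seq c n ℚ.≤ seq d n ℚ.+ f e → seq u n ℚ.≤ seq v n ℚ.+ e) →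
  a ≤ℝ b → c ≤ℝ d → u ≤ℝ v
≤ℝ-lift₂ f f-pos g a≤b c≤d e 0<e =
  let M , h = a≤b (f e) (f-pos e 0<e)
      N , k = c≤d (f e) (f-pos e 0<e)
  in M ℕ.⊔ N , λ n p → g n (h n (ℕ.m⊔n≤o⇒m≤o M N p)) (k n (ℕ.m⊔n≤o⇒n≤o M N p))

halves : ∀ e → ½ ℚ.* e ℚ.+ ½ ℚ.* e ≡ e
halves e = trans (sym (ℚ.*-distribʳ-+ e ½ ½)) (ℚ.*-identityˡ e)

seq-≤⇒≤ℝ : ∀ {x y} → (∀ n → seq x n ℚ.≤ seq y n) → x ≤ℝ y
seq-≤⇒≤ℝ {x} {y} x≤y e 0<e = 0 , λ n _ → begin
  seq x n             ≤⟨ x≤y n ⟩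
  seq y n             ≡⟨ ℚ.+-identityʳ (seq y n) ⟨
  seq y n ℚ.+ 0ℚ      ≤⟨ ℚ.+-monoʳ-≤ (seq y n) (ℚ.<⇒≤ 0<e) ⟩
  seq y n ℚ.+ e       ∎
  where open ℚ.≤-Reasoning

≤ℝ-trans : ∀ {x y z} → x ≤ℝ y → y ≤ℝ z → x ≤ℝ z
≤ℝ-trans {x} {y} {z} = ≤ℝ-lift₂ (½ ℚ.*_) half-pos {x} {y} {y} {z} {x} {z} λ n {e} x≤y y≤z → begin
  seq x n                               ≤⟨ x≤y ⟩
  seq y n ℚ.+ ½ ℚ.* e                   ≤⟨ ℚ.+-monoˡ-≤ (½ ℚ.* e) y≤z ⟩
  (seq z n ℚ.+ ½ ℚ.* e) ℚ.+ ½ ℚ.* e     ≡⟨ ℚ.+-assoc (seq z n) (½ ℚ.* e) (½ ℚ.* e) ⟩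
  seq z n ℚ.+ (½ ℚ.* e ℚ.+ ½ ℚ.* e)     ≡⟨ cong (seq z n ℚ.+_) (halves e) ⟩
  seq z n ℚ.+ e                         ∎
  where open ℚ.≤-Reasoning

+ℝ-mono-≤ : ∀ {a b c d} → a ≤ℝ b → c ≤ℝ d → a +ℝ c ≤ℝ b +ℝ d
+ℝ-mono-≤ {a} {b} {c} {d} = ≤ℝ-lift₂ (½ ℚ.*_) half-pos {a} {b} {c} {d} {a +ℝ c} {b +ℝ d} λ n {e} a≤b c≤d → begin
  seq a n ℚ.+ seq c n                                     ≤⟨ ℚ.+-mono-≤ a≤b c≤d ⟩
  (seq b n ℚ.+ ½ ℚ.* e) ℚ.+ (seq d n ℚ.+ ½ ℚ.* e)         ≡⟨ solve 3 (λ b d h → (b :+ h) :+ (d :+ h) := (b :+ d) :+ (h :+ h)) refl (seq b n) (seq d n) (½ ℚ.* e) ⟩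
  (seq b n ℚ.+ seq d n) ℚ.+ (½ ℚ.* e ℚ.+ ½ ℚ.* e)         ≡⟨ cong ((seq b n ℚ.+ seq d n) ℚ.+_) (halves e) ⟩
  (seq b n ℚ.+ seq d n) ℚ.+ e                             ∎
  where open ℚ.≤-Reasoning
        open +-*-Solver

-ℝ-anti-≤ : ∀ {x y} → x ≤ℝ y → -ℝ y ≤ℝ -ℝ x
-ℝ-anti-≤ {x} {y} = ≤ℝ-lift₁ {x} {y} { -ℝ y} { -ℝ x} λ n {e} x≤y → begin
  ℚ.- seq y n                                       ≡⟨ solve 2 (λ x y → :- y := x :+ (:- x :- y)) refl (seq x n) (seq y n) ⟩
  seq x n ℚ.+ (ℚ.- seq x n ℚ.- seq y n)             ≤⟨ ℚ.+-monoˡ-≤ (ℚ.- seq x n ℚ.- seq y n) x≤y ⟩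
  (seq y n ℚ.+ e) ℚ.+ (ℚ.- seq x n ℚ.- seq y n)     ≡⟨ solve 3 (λ x y e → (y :+ e) :+ (:- x :- y) := :- x :+ e) refl (seq x n) (seq y n) e ⟩
  ℚ.- seq x n ℚ.+ e                                 ∎
  where open ℚ.≤-Reasoning
        open +-*-Solver

-- At each index the rational minimum is one of the two terms, although no such choice is made for
-- the reals themselves.
⊓ℝ-glb : ∀ {x y z} → z ≤ℝ x → z ≤ℝ y → z ≤ℝ x ⊓ℝ y
⊓ℝ-glb {x} {y} {z} = ≤ℝ-lift₂ (λ e → e) (λ _ p → p) {z} {x} {z} {y} {z} {x ⊓ℝ y} glb
  where
  glb : ∀ n {e} → seq z n ℚ.≤ seq x n ℚ.+ e → seq z n ℚ.≤ seq y n ℚ.+ e →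
        seq z n ℚ.≤ (seq x n ℚ.⊓ seq y n) ℚ.+ e
  glb n {e} z≤x z≤y with ℚ.⊓-sel (seq x n) (seq y n)
  ... | inj₁ eq = subst (λ m → seq z n ℚ.≤ m ℚ.+ e) (sym eq) z≤x
  ... | inj₂ eq = subst (λ m → seq z n ℚ.≤ m ℚ.+ e) (sym eq) z≤y

≈ℝ-sym : ∀ {x y} → x ≈ℝ y → y ≈ℝ x
≈ℝ-sym {x} {y} x≈y e 0<e = let N , h = x≈y e 0<e in
  N , λ n N≤n → subst (ℚ._< e) (swap-∣-∣ (seq x n) (seq y n)) (h n N≤n)

≈ℝ⇒≤ℝ : ∀ {x y} → x ≈ℝ y → x ≤ℝ y
≈ℝ⇒≤ℝ x≈y e 0<e = let N , h = x≈y e 0<e in N , λ n N≤n → ℚ.<⇒≤ (below (h n N≤n))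

≤ℝ-antisym : ∀ {x y} → x ≤ℝ y → y ≤ℝ x → x ≈ℝ y
≤ℝ-antisym {x} {y} x≤y y≤x e 0<e =
  -- Half the tolerance leaves room to pass from the weak inequalities of `_≤ℝ_` to the strict ones
  -- of `_≈ℝ_`.
  let M , h = x≤y (½ ℚ.* e) (half-pos e 0<e)
      N , k = y≤x (½ ℚ.* e) (half-pos e 0<e)
  in M ℕ.⊔ N , λ n p → close
       (strict (seq y n) (h n (ℕ.m⊔n≤o⇒m≤o M N p)))
       (strict (seq x n) (k n (ℕ.m⊔n≤o⇒n≤o M N p)))
  where
  ½e<e : ½ ℚ.* e ℚ.< e
  ½e<e = begin-strict
    ½ ℚ.* e                  ≡⟨ ℚ.+-identityʳ (½ ℚ.* e) ⟨
    ½ ℚ.* e ℚ.+ 0ℚ           <⟨ ℚ.+-monoʳ-< (½ ℚ.* e) (half-pos e 0<e) ⟩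
    ½ ℚ.* e ℚ.+ ½ ℚ.* e      ≡⟨ halves e ⟩
    e                        ∎
    where open ℚ.≤-Reasoning
  strict : ∀ {a} b → a ℚ.≤ b ℚ.+ ½ ℚ.* e → a ℚ.< b ℚ.+ e
  strict b a≤ = ℚ.≤-<-trans a≤ (ℚ.+-monoʳ-< b ½e<e)

seq-≡⇒≈ℝ : ∀ {x y} → (∀ n → seq x n ≡ seq y n) → x ≈ℝ y
seq-≡⇒≈ℝ {x} {y} x≡y = ≤ℝ-antisym {x} {y}
  (seq-≤⇒≤ℝ {x} {y} (ℚ.≤-reflexive ∘ x≡y)) (seq-≤⇒≤ℝ {y} {x} (ℚ.≤-reflexive ∘ sym ∘ x≡y))

≈ℝ-isEquivalence : IsEquivalence _≈ℝ_
≈ℝ-isEquivalence = record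
  { refl  = λ {x} → seq-≡⇒≈ℝ {x} {x} λ _ → refl
  ; sym   = λ {x} {y} → ≈ℝ-sym {x} {y}
  ; trans = λ {x} {y} {z} x≈y y≈z → ≤ℝ-antisym {x} {z}
      (≤ℝ-trans {x} {y} {z} (≈ℝ⇒≤ℝ {x} {y} x≈y) (≈ℝ⇒≤ℝ {y} {z} y≈z))
      (≤ℝ-trans {z} {y} {x} (≈ℝ⇒≤ℝ {z} {y} (≈ℝ-sym {y} {z} y≈z)) (≈ℝ⇒≤ℝ {y} {x} (≈ℝ-sym {x} {y} x≈y))) }

-- Equality is `_≤ℝ_` both ways, so congruence follows from monotonicity.
+ℝ-cong : ∀ {a b c d} → a ≈ℝ b → c ≈ℝ d → a +ℝ c ≈ℝ b +ℝ d
+ℝ-cong {a} {b} {c} {d} a≈b c≈d = ≤ℝ-antisym {a +ℝ c} {b +ℝ d}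
  (+ℝ-mono-≤ {a} {b} {c} {d} (≈ℝ⇒≤ℝ {a} {b} a≈b) (≈ℝ⇒≤ℝ {c} {d} c≈d))
  (+ℝ-mono-≤ {b} {a} {d} {c} (≈ℝ⇒≤ℝ {b} {a} (≈ℝ-sym {a} {b} a≈b)) (≈ℝ⇒≤ℝ {d} {c} (≈ℝ-sym {c} {d} c≈d)))

-ℝ-cong : ∀ {x y} → x ≈ℝ y → -ℝ x ≈ℝ -ℝ y
-ℝ-cong {x} {y} x≈y = ≤ℝ-antisym { -ℝ x} { -ℝ y}
  (-ℝ-anti-≤ {y} {x} (≈ℝ⇒≤ℝ {y} {x} (≈ℝ-sym {x} {y} x≈y))) (-ℝ-anti-≤ {x} {y} (≈ℝ⇒≤ℝ {x} {y} x≈y))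

+ℝ-isAbelianGroup : IsAbelianGroup _≈ℝ_ _+ℝ_ 0ℝ -ℝ_
+ℝ-isAbelianGroup = record
  { isGroup = record
    { isMonoid = record
      { isSemigroup = record
        { isMagma = record
          { isEquivalence = ≈ℝ-isEquivalence
          ; ∙-cong        = λ {a} {b} {c} {d} → +ℝ-cong {a} {b} {c} {d} }
        ; assoc = λ x y z → seq-≡⇒≈ℝ {(x +ℝ y) +ℝ z} {x +ℝ (y +ℝ z)}
            λ n → ℚ.+-assoc (seq x n) (seq y n) (seq z n) }
      ; identity = (λ x → seq-≡⇒≈ℝ {0ℝ +ℝ x} {x} λ n → ℚ.+-identityˡ (seq x n))
                 , (λ x → seq-≡⇒≈ℝ {x +ℝ 0ℝ} {x} λ n → ℚ.+-identityʳ (seq x n)) }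
    ; inverse = (λ x → seq-≡⇒≈ℝ {(-ℝ x) +ℝ x} {0ℝ} λ n → ℚ.+-inverseˡ (seq x n))
              , (λ x → seq-≡⇒≈ℝ {x +ℝ (-ℝ x)} {0ℝ} λ n → ℚ.+-inverseʳ (seq x n))
    ; ⁻¹-cong = λ {x} {y} → -ℝ-cong {x} {y} }
  ; comm = λ x y → seq-≡⇒≈ℝ {x +ℝ y} {y +ℝ x} λ n → ℚ.+-comm (seq x n) (seq y n) }

ℝ-isMeetOrderedGroup : IsMeetOrderedGroup ℝ-scalars
ℝ-isMeetOrderedGroup = record
  { isAbelianGroup    = +ℝ-isAbelianGroup
  ; isMeetSemilattice = record
    { isPartialOrder = record
      { isPreorder = record
        { isEquivalence = ≈ℝ-isEquivalence
        ; reflexive     = λ {x} {y} → ≈ℝ⇒≤ℝ {x} {y}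
        ; trans         = λ {x} {y} {z} → ≤ℝ-trans {x} {y} {z} }
      ; antisym = λ {x} {y} → ≤ℝ-antisym {x} {y} }
    ; infimum = λ x y →
        seq-≤⇒≤ℝ {x ⊓ℝ y} {x} (λ n → ℚ.p⊓q≤p (seq x n) (seq y n)) ,
        seq-≤⇒≤ℝ {x ⊓ℝ y} {y} (λ n → ℚ.p⊓q≤q (seq x n) (seq y n)) ,
        λ z → ⊓ℝ-glb {x} {y} {z} }
  ; +-mono-≤ = λ {a} {b} {c} {d} → +ℝ-mono-≤ {a} {b} {c} {d} }

theorem4p1 : ( (n : ℕ) (D₁ D₂ : System ℤ-scalars n) (S S₁ S₂ : PointSet ℤ-scalars n) →
    IsLConvex ℤ-scalars S₁ → IsLConvex ℤ-scalars S₂ →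
    S₁ ≐ Solutions ℤ-scalars D₁ → S₂ ≐ Solutions ℤ-scalars D₂ →
    S ≐ MinkowskiSum ℤ-scalars S₁ S₂ →
    S ≐ Graph.CycleInequalities ℤ-scalars D₁ D₂ )
    ×
    ( (n : ℕ) (D₁ D₂ : System ℝ-scalars n) (P P₁ P₂ : PointSet ℝ-scalars n) →
    IsLConvex ℝ-scalars P₁ → IsLConvex ℝ-scalars P₂ →
    P₁ ≐ Solutions ℝ-scalars D₁ → P₂ ≐ Solutions ℝ-scalars D₂ →
    P ≐ MinkowskiSum ℝ-scalars P₁ P₂ →
    P ≐ Graph.CycleInequalities ℝ-scalars D₁ D₂ )
theorem4p1 =
  (λ n D₁ D₂ S S₁ S₂ → Decomposability.sum≐cycleInequalities ℤ-isMeetOrderedGroup D₁ D₂) ,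
  (λ n D₁ D₂ P P₁ P₂ → Decomposability.sum≐cycleInequalities ℝ-isMeetOrderedGroup D₁ D₂)
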